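{- Let $k$ be a positive integer, let $p \in [\tfrac{2}{3},1)$, and let $n$ be an integer with $n \geq \max\left(4k^2 - 4k + 3,\ \frac{1}{1-p}(k^2-1) + 2\right)$. Let $H$ be a complete multipartite subgraph of the complement of $\mathrm{Kneser}(n,k)$ such that no colour class (part) of $H$ contains more than $p|H|$ vertices. Then $|H| \leq \binom{n-1}{k-1}$.
   Context: The Kneser graph $\mathrm{Kneser}(n,k)$ has as vertex set the family of all $k$-element subsets of $[n]=\{1,\dots,n\}$, two vertices adjacent iff they are disjoint; its complement therefore has two $k$-sets adjacent iff they intersect. A complete multipartite subgraph $H$ of a graph is a subgraph whose vertex set is partitioned into colour classes (parts) such that any two vertices in different classes are adjacent in $H$. $|H|$ denotes the number of vertices of $H$.
   Formalization: The number p in [2/3, 1) is taken to be rational; the case of real p follows by replacing p with max(2/3, (largest part size)/|H|). -}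

module Defs where

open import Data.Nat using (ℕ; suc)
open import Data.Nat.Properties using (_≟_)
open import Data.Fin using (Fin)
open import Data.Fin.Subset using (Subset; ∣_∣; _∩_; Nonempty)
open import Data.List using (length; filter)
open import Data.List.Base using (allFin)
open import Data.Integer using (+_)
open import Data.Rational using (ℚ; _/_)
open import Relation.Binary.PropositionalEquality using (_≡_)
open import Relation.Nullary using (¬_)
open import Function.Definitions using (Injective)

ℕ→ℚ : ℕ → ℚ
ℕ→ℚ m = + m / 1

IsKSet : (n k : ℕ) → Subset n → Set
IsKSet n k s = ∣ s ∣ ≡ k

-- A complete multipartite subgraph H of the complement of Kneser(n,k) with
-- |H| = m vertices: an injective listing of m k-subsets of [n] together with
-- a colouring of them into colour classes (parts, labelled by ℕ) such that
-- any two vertices in different classes are adjacent in complement-Kneser.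
record CompleteMultipartiteSub (n k m : ℕ) : Set where
  field
    vertex    : Fin m → Subset n
    injective : Injective _≡_ _≡_ vertex
    isKSet    : ∀ i → IsKSet n k (vertex i)
    colour    : Fin m → ℕ
    crossAdj  : ∀ i j → ¬ (colour i ≡ colour j) → Nonempty (vertex i ∩ vertex j)

partSize : {n k m : ℕ} → CompleteMultipartiteSub n k m → ℕ → ℕ
partSize {m = m} H c =
  length (filter (λ i → CompleteMultipartiteSub.colour H i ≟ c) (allFin m))

{-# OPTIONS --safe #-}
module Submission where

-- Assume |H| exceeds S = C(n-1,k-1) and let D = C(n-2,k-2). Since p ≥ 2/3, the parts can be grouped
-- into two cross-intersecting families A and B, each with at least (1-p)|H| members. If some b ∈ B
-- avoids a point x, then at most kD members of A contain x. Hence, when all members of A and B meet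
-- a two-element set {x,y}, either A and B lie in a common star or |A| + |B| ≤ 4kD ≤ S.
--
-- Compressing A and B by adjacent shifts therefore loses nothing: if the shifted families lie in a
-- common star, then the original ones meet a two-element set, hence lie in a common star too.
-- For fully shifted A and B, Frankl's walk argument shows that either all walks of B reach height 2,
-- which makes B too small, or all walks of A reach height 1. In the latter case, if some b ∈ B avoids
-- the first point, then at most kD members of A contain it and at most C(n-1,k-2) avoid it, which is
-- less than (1-p)S. So A and B lie in a common star, and |H| ≤ S after all.

open import Defs
open import Data.Nat hiding (_/_)
open import Data.Nat.Properties
open import Data.Nat.Combinatorics using (_C_; nC1≡n; nCk≡nC[n∸k]; nCn≡1; nCk+nC[k+1]≡[n+1]C[k+1])
open import Data.Nat.Induction using (<-wellFounded)
open import Data.Nat.Solver using (module +-*-Solver)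
import Data.Integer as ℤ
import Data.Integer.Properties as ℤ
import Data.Integer.Tactic.RingSolver as ℤ
open import Data.Rational using (ℚ; mkℚ; _/_; 1ℚ; _-_; -_; toℚᵘ) renaming (_≤_ to _≤ℚ_; _<_ to _<ℚ_; _*_ to _*ℚ_; _+_ to _+ℚ_)
import Data.Rational as ℚ
import Data.Rational.Properties as ℚ
open import Data.Rational.Unnormalised as ℚᵘ using (ℚᵘ; mkℚᵘ; _≃_; *≡*; *≤*)
import Data.Rational.Unnormalised.Properties as ℚᵘ
open import Data.Bool as Bool using (Bool; true; false; _∧_; _∨_; not)
open import Data.Fin using (Fin; zero; suc)
open import Data.Fin.Properties using () renaming (suc-injective to sucᶠ-injective)
open import Data.Fin.Subset using (Subset; ∣_∣; _∩_; Nonempty)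
open import Data.Vec using ([]; _∷_; lookup; toList; there)
open import Data.Vec.Properties using (≡-dec)
open import Data.List using (List; []; _∷_; _++_; replicate; length; filter; tabulate)
open import Data.List.Properties using (∷-injective)
open import Data.Product using (_×_; _,_; ∃-syntax; proj₁; proj₂)
open import Data.Sum using (_⊎_; inj₁; inj₂)
open import Data.Empty using (⊥; ⊥-elim)
open import Function using (_∘_; id)
open import Function.Definitions using (Injective)
open import Induction.WellFounded using (Acc; acc)
open import Relation.Nullary using (¬_; Dec; yes; no; does)
open import Relation.Nullary.Decidable using (dec-true)
open import Relation.Unary using (Decidable)
open import Relation.Binary.PropositionalEquality

-- Counting uniform families

-- n C (k - u), and 0 for k < u
choose : ℕ → ℕ → ℕ → ℕ
choose n zero    k       = n C k
choose n (suc u) zero    = 0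
choose n (suc u) (suc k) = choose n u k

nC0≡1 : ∀ n → n C 0 ≡ 1
nC0≡1 n = trans (nCk≡nC[n∸k] {0} {n} z≤n) (nCn≡1 n)

choose-pascal : ∀ n u k → choose (suc n) u k ≡ choose n u k + choose n (suc u) k
choose-pascal n zero    zero    = trans (nC0≡1 (suc n)) (sym (trans (+-identityʳ _) (nC0≡1 n)))
choose-pascal n zero    (suc k) = trans (sym (nCk+nC[k+1]≡[n+1]C[k+1] n k)) (+-comm (n C k) _)
choose-pascal n (suc u) zero    = refl
choose-pascal n (suc u) (suc k) = choose-pascal n u k

choose-mono : ∀ n u k → choose n u k ≤ choose (suc n) u k
choose-mono n u k = ≤-trans (m≤m+n _ _) (≤-reflexive (sym (choose-pascal n u k)))

choose-diag : ∀ n u → choose n u u ≡ 1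
choose-diag n zero    = nC0≡1 n
choose-diag n (suc u) = choose-diag n u

-- Membership is Boolean so that a family can be sliced at its first coordinate; the cardinality
-- bounds below then go by induction on the ground set, with Pascal's rule adding up the two slices.
Family : ℕ → Set
Family n = Subset n → Bool

infix 4 _∋_
_∋_ : ∀ {n} → Family n → Subset n → Set
A ∋ x = A x ≡ true

infixl 8 _▸_
_▸_ : ∀ {n} → Family (suc n) → Bool → Family n
(A ▸ b) x = A (b ∷ x)

false≢true : false ≡ true → ⊥
false≢true ()

ind : Bool → ℕ
ind false = 0
ind true  = 1

card : ∀ {n} → Family n → ℕ
card {zero}  A = ind (A [])
card {suc n} A = card (A ▸ false) + card (A ▸ true)

_⊑_ : ∀ {n} → Family n → Family n → Set
A ⊑ B = ∀ x → A ∋ x → B ∋ x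

ind-mono : ∀ {a b} → (a ≡ true → b ≡ true) → ind a ≤ ind b
ind-mono {false} h = z≤n
ind-mono {true}  h rewrite h refl = ≤-refl

card-mono : ∀ {n} {A B : Family n} → A ⊑ B → card A ≤ card B
card-mono {zero}  h = ind-mono (h [])
card-mono {suc n} h = +-mono-≤ (card-mono (λ x → h (false ∷ x))) (card-mono (λ x → h (true ∷ x)))

card-mono-< : ∀ {n} {A B : Family n} → A ⊑ B → ∀ x → A x ≡ false → B ∋ x → card A < card B
card-mono-< {zero} h [] p q rewrite p | q = s≤s z≤n
card-mono-< {suc n} h (false ∷ x) p q =
  +-mono-<-≤ (card-mono-< (λ y → h (false ∷ y)) x p q) (card-mono (λ y → h (true ∷ y)))
card-mono-< {suc n} h (true ∷ x) p q =
  +-mono-≤-< (card-mono (λ y → h (false ∷ y))) (card-mono-< (λ y → h (true ∷ y)) x p q)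

∅ᶠ : ∀ {n} → Family n
∅ᶠ _ = false

card-∅ : ∀ n → card (∅ᶠ {n}) ≡ 0
card-∅ zero    = refl
card-∅ (suc n) = cong₂ _+_ (card-∅ n) (card-∅ n)

card-empty : ∀ {n} {A : Family n} → (∀ x → ¬ A ∋ x) → card A ≡ 0
card-empty {n} {A} h = n≤0⇒n≡0 (subst (card A ≤_) (card-∅ n) (card-mono (λ x p → ⊥-elim (h x p))))

_∪ᶠ_ _∩ᶠ_ : ∀ {n} → Family n → Family n → Family n
(A ∪ᶠ B) x = A x ∨ B x
(A ∩ᶠ B) x = A x ∧ B x

swap-mid : ∀ a b c d → (a + b) + (c + d) ≡ (a + c) + (b + d)
swap-mid = solve 4 (λ a b c d → (a :+ b) :+ (c :+ d) := (a :+ c) :+ (b :+ d)) refl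
  where open +-*-Solver

ind-∪∩ : ∀ a b → ind (a ∨ b) + ind (a ∧ b) ≡ ind a + ind b
ind-∪∩ false b = +-identityʳ _
ind-∪∩ true  b = refl

card-∪∩ : ∀ {n} (A B : Family n) → card (A ∪ᶠ B) + card (A ∩ᶠ B) ≡ card A + card B
card-∪∩ {zero}  A B = ind-∪∩ (A []) (B [])
card-∪∩ {suc n} A B = begin
  _ ≡⟨ swap-mid (card ((A ▸ false) ∪ᶠ (B ▸ false))) _ _ _ ⟩
  _ ≡⟨ cong₂ _+_ (card-∪∩ (A ▸ false) (B ▸ false)) (card-∪∩ (A ▸ true) (B ▸ true)) ⟩
  _ ≡⟨ swap-mid (card (A ▸ false)) _ _ _ ⟩
  _ ∎
  where open ≡-Reasoning

card-∪-≤ : ∀ {n} {A B E : Family n} → (∀ x → A ∋ x → B ∋ x ⊎ E ∋ x) → card A ≤ card B + card E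
card-∪-≤ {A = A} {B} {E} h = begin
  card A                          ≤⟨ card-mono sub ⟩
  card (B ∪ᶠ E)                   ≤⟨ m≤m+n _ _ ⟩
  card (B ∪ᶠ E) + card (B ∩ᶠ E)   ≡⟨ card-∪∩ B E ⟩
  card B + card E                 ∎
  where
  open ≤-Reasoning
  sub : A ⊑ (B ∪ᶠ E)
  sub x p with B x | h x p
  ... | true  | _      = refl
  ... | false | inj₂ q = q

meets : ∀ {n} → Subset n → Subset n → Bool
meets []      []      = false
meets (a ∷ x) (b ∷ y) = (a ∧ b) ∨ meets x y

-- The offset u lets uniformity pass to slices: it counts the elements already fixed.
Uniform : ℕ → ℕ → ∀ {n} → Family n → Set
Uniform u k A = ∀ x → A ∋ x → u + ∣ x ∣ ≡ k

uniform-▸true : ∀ {u k n} {A : Family (suc n)} → Uniform u k A → Uniform (suc u) k (A ▸ true)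
uniform-▸true {u} U x p = trans (sym (+-suc u _)) (U (true ∷ x) p)

uniform-▸false : ∀ {u k n} {A : Family (suc n)} → Uniform u k A → Uniform u k (A ▸ false)
uniform-▸false U x p = U (false ∷ x) p

card-uniform : ∀ {u k n} {A : Family n} → Uniform u k A → card A ≤ choose n u k
card-uniform {u} {k} {zero} {A} U with A [] in eq
... | false = z≤n
... | true rewrite sym (U [] eq) | +-identityʳ u = ≤-reflexive (sym (choose-diag 0 u))
card-uniform {u} {k} {suc n} U rewrite choose-pascal n u k =
  +-mono-≤ (card-uniform (uniform-▸false U)) (card-uniform (uniform-▸true U))

card-star : ∀ {u k n} {A : Family (suc n)} → Uniform u k A → ∀ p → (∀ x → A ∋ x → lookup x p ≡ true) →
  card A ≤ choose n (suc u) k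
card-star {A = A} U zero h
  rewrite card-empty {A = A ▸ false} (λ x q → false≢true (h (false ∷ x) q)) = card-uniform (uniform-▸true U)
card-star {u} {k} {suc n} U (suc p) h rewrite choose-pascal n (suc u) k =
  +-mono-≤ (card-star (uniform-▸false U) p (λ x → h (false ∷ x)))
           (card-star (uniform-▸true U) p (λ x → h (true ∷ x)))

-- A union bound over the points of `b`: fixing one of them leaves `n` points and one element fewer
-- to choose.
card-meeting : ∀ {u k n} {A : Family (suc n)} → Uniform u k A → ∀ b → (∀ x → A ∋ x → meets x b ≡ true) →
  card A ≤ ∣ b ∣ * choose n (suc u) k
card-meeting {u} {k} {n} {A} U (true ∷ b) h = begin
  card (A ▸ false) + card (A ▸ true)                             ≤⟨ +-mono-≤ (avoiding b A U h) (card-uniform (uniform-▸true U)) ⟩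
  ∣ b ∣ * choose n (suc u) k + choose n (suc u) k                ≡⟨ +-comm _ (choose n (suc u) k) ⟩
  choose n (suc u) k + ∣ b ∣ * choose n (suc u) k                ∎
  where
  open ≤-Reasoning
  avoiding : ∀ {n} b (A : Family (suc n)) → Uniform u k A → (∀ x → A ∋ x → meets x (true ∷ b) ≡ true) →
    card (A ▸ false) ≤ ∣ b ∣ * choose n (suc u) k
  avoiding {zero} [] A U h = ≤-reflexive (card-empty {A = A ▸ false} λ { [] q → false≢true (h (false ∷ []) q) })
  avoiding {suc n} b A U h =
    ≤-trans (card-meeting (uniform-▸false U) b (λ x → h (false ∷ x)))
            (*-monoʳ-≤ ∣ b ∣ (choose-mono n (suc u) k))
card-meeting {n = zero} {A} U (false ∷ []) h =
  ≤-reflexive (cong₂ _+_ (card-empty {A = A ▸ false} λ { [] q → false≢true (h (false ∷ []) q) })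
                         (card-empty {A = A ▸ true} λ { [] q → false≢true (h (true ∷ []) q) }))
card-meeting {u} {k} {suc n} {A} U (false ∷ b) h rewrite choose-pascal n (suc u) k | *-distribˡ-+ ∣ b ∣ (choose n (suc u) k) (choose n (suc (suc u)) k) =
  +-mono-≤ (card-meeting (uniform-▸false U) b (λ x → h (false ∷ x)))
           (card-meeting (uniform-▸true U) b (λ x → h (true ∷ x)))

-- Since `b` avoids `p`, every member contains `p` and a second point taken from `b`. A union bound
-- over that point fixes two elements among `2 + n`. This is the bound kD of the overview.
card-star-meeting : ∀ {u k n} {A : Family (suc (suc n))} → Uniform u k A → ∀ p b → lookup b p ≡ false →
  (∀ x → A ∋ x → lookup x p ≡ true) → (∀ x → A ∋ x → meets x b ≡ true) →
  card A ≤ ∣ b ∣ * choose n (suc (suc u)) k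
card-star-meeting {A = A} U zero (false ∷ b) r h m
  rewrite card-empty {A = A ▸ false} (λ x q → false≢true (h (false ∷ x) q)) =
  card-meeting (uniform-▸true U) b (λ x → m (true ∷ x))
card-star-meeting {u} {k} {zero} {A} U (suc zero) (true ∷ false ∷ []) r h m
  rewrite card-empty {A = A ▸ false ▸ true} (λ { [] q → false≢true (m _ q) })
        | card-empty {A = A ▸ false ▸ false} (λ { [] q → false≢true (m _ q) }) =
  ≤-trans (card-star (uniform-▸true U) zero (λ x → h (true ∷ x))) (≤-reflexive (sym (*-identityˡ (choose 0 (2 + u) k))))
card-star-meeting {u} {k} {suc n} {A} U (suc p) (true ∷ b) r h m = begin
  card (A ▸ false) + card (A ▸ true)                             ≤⟨ +-mono-≤ avoiding (card-star (uniform-▸true U) p (λ x → h (true ∷ x))) ⟩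
  ∣ b ∣ * choose (suc n) (2 + u) k + choose (suc n) (2 + u) k    ≡⟨ +-comm _ (choose (suc n) (2 + u) k) ⟩
  choose (suc n) (2 + u) k + ∣ b ∣ * choose (suc n) (2 + u) k    ∎
  where
  open ≤-Reasoning
  avoiding : card (A ▸ false) ≤ ∣ b ∣ * choose (suc n) (2 + u) k
  avoiding = ≤-trans (card-star-meeting (uniform-▸false U) p b r (λ x → h (false ∷ x)) (λ x → m (false ∷ x)))
            (*-monoʳ-≤ ∣ b ∣ (choose-mono n (2 + u) k))
card-star-meeting {u} {k} {zero} {A} U (suc zero) (false ∷ false ∷ []) r h m =
  card-meeting U (false ∷ false ∷ []) m
card-star-meeting {u} {k} {suc n} {A} U (suc p) (false ∷ b) r h m rewrite choose-pascal n (2 + u) k | *-distribˡ-+ ∣ b ∣ (choose n (2 + u) k) (choose n (3 + u) k) =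
  +-mono-≤ (card-star-meeting (uniform-▸false U) p b r (λ x → h (false ∷ x)) (λ x → m (false ∷ x)))
           (card-star-meeting (uniform-▸true U) p b r (λ x → h (true ∷ x)) (λ x → m (true ∷ x)))

-- Read a subset as a walk that goes up at an element and down at a non-element: does it reach height u?
hits : ∀ {n} → ℕ → Subset n → Bool
hits zero    x           = true
hits (suc u) []          = false
hits (suc u) (true ∷ x)  = hits u x
hits (suc u) (false ∷ x) = hits (2 + u) x

-- The bound of the reflection principle, by induction on the first step: from height `suc v` still
-- to climb, a down step leaves `2 + v` and an up step leaves `v`, and the two bounds add up by
-- Pascal's rule.
card-hits : ∀ {u k n} {A : Family n} v → Uniform u k A → (∀ x → A ∋ x → hits v x ≡ true) →
  card A ≤ choose n (u + v) k
card-hits {u} {k} {n} {A} zero U h = subst (λ w → card A ≤ choose n w k) (sym (+-identityʳ u)) (card-uniform U)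
card-hits {n = zero} {A} (suc v) U h = ≤-trans (≤-reflexive (card-empty {A = A} λ { [] q → false≢true (h [] q) })) z≤n
card-hits {u} {k} {suc n} {A} (suc v) U h rewrite +-suc u v = begin
  card (A ▸ false) + card (A ▸ true)
    ≤⟨ +-mono-≤ (card-hits (2 + v) (uniform-▸false U) (λ x → h (false ∷ x)))
                (card-hits v (uniform-▸true U) (λ x → h (true ∷ x))) ⟩
  choose n (u + (2 + v)) k + choose n (suc (u + v)) k
    ≡⟨ cong (λ w → choose n w k + choose n (suc (u + v)) k) (trans (+-suc u (suc v)) (cong suc (+-suc u v))) ⟩
  choose n (2 + (u + v)) k + choose n (suc (u + v)) k
    ≡⟨ +-comm (choose n (2 + (u + v)) k) _ ⟩
  choose n (suc (u + v)) k + choose n (2 + (u + v)) k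
    ≡⟨ choose-pascal n (suc (u + v)) k ⟨
  choose (suc n) (suc (u + v)) k ∎
  where open ≤-Reasoning

-- Shifting

Crossing : ∀ {n} → Family n → Family n → Set
Crossing A B = ∀ x y → A ∋ x → B ∋ y → meets x y ≡ true

-- (shift j A) is the compression that replaces the element j + 1 by j.
shift : ∀ {n} → ℕ → Family n → Family n
shift zero    A []                   = A []
shift zero    A (b ∷ [])             = A (b ∷ [])
shift zero    A (true ∷ false ∷ x)   = A (true ∷ false ∷ x) ∨ A (false ∷ true ∷ x)
shift zero    A (false ∷ true ∷ x)   = A (true ∷ false ∷ x) ∧ A (false ∷ true ∷ x)
shift zero    A (true ∷ true ∷ x)    = A (true ∷ true ∷ x)
shift zero    A (false ∷ false ∷ x)  = A (false ∷ false ∷ x)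
shift (suc j) A []                   = A []
shift (suc j) A (b ∷ x)              = shift j (A ▸ b) x

swap : ∀ {n} → ℕ → Subset n → Subset n
swap zero    []          = []
swap zero    (a ∷ [])    = a ∷ []
swap zero    (a ∷ b ∷ x) = b ∷ a ∷ x
swap (suc j) []          = []
swap (suc j) (a ∷ x)     = a ∷ swap j x

swapᶠ : ∀ {n} → ℕ → Fin n → Fin n
swapᶠ {suc zero}    zero    p             = p
swapᶠ {suc (suc n)} zero    zero          = suc zero
swapᶠ {suc (suc n)} zero    (suc zero)    = zero
swapᶠ {suc (suc n)} zero    (suc (suc p)) = suc (suc p)
swapᶠ               (suc j) zero          = zero
swapᶠ               (suc j) (suc p)       = suc (swapᶠ j p)

lookup-swap : ∀ {n} j (x : Subset n) p → lookup (swap j x) p ≡ lookup x (swapᶠ j p)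
lookup-swap zero    (a ∷ [])    p             = refl
lookup-swap zero    (a ∷ b ∷ x) zero          = refl
lookup-swap zero    (a ∷ b ∷ x) (suc zero)    = refl
lookup-swap zero    (a ∷ b ∷ x) (suc (suc p)) = refl
lookup-swap (suc j) (a ∷ x)     zero          = refl
lookup-swap (suc j) (a ∷ x)     (suc p)       = lookup-swap j x p

∣swap∣ : ∀ {n} j (x : Subset n) → ∣ swap j x ∣ ≡ ∣ x ∣
∣swap∣ zero    []                  = refl
∣swap∣ zero    (a ∷ [])            = refl
∣swap∣ zero    (true ∷ true ∷ x)   = refl
∣swap∣ zero    (true ∷ false ∷ x)  = refl
∣swap∣ zero    (false ∷ true ∷ x)  = refl
∣swap∣ zero    (false ∷ false ∷ x) = refl
∣swap∣ (suc j) []                  = refl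
∣swap∣ (suc j) (true ∷ x)          = cong suc (∣swap∣ j x)
∣swap∣ (suc j) (false ∷ x)         = ∣swap∣ j x

∨-elim : ∀ a {b} → a ∨ b ≡ true → a ≡ true ⊎ b ≡ true
∨-elim true  p = inj₁ refl
∨-elim false p = inj₂ p

∨-intro₂ : ∀ a {b} → b ≡ true → a ∨ b ≡ true
∨-intro₂ true  p = refl
∨-intro₂ false p = p

∨-intro₁ : ∀ {a b} → a ≡ true → a ∨ b ≡ true
∨-intro₁ refl = refl

∧-elim : ∀ a {b} → a ∧ b ≡ true → a ≡ true × b ≡ true
∧-elim true p = refl , p

shift-⊆ : ∀ {n} j (A : Family n) x → shift j A ∋ x → A ∋ x ⊎ A ∋ swap j x
shift-⊆ zero    A []                  p = inj₁ p
shift-⊆ zero    A (b ∷ [])            p = inj₁ p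
shift-⊆ zero    A (true ∷ true ∷ x)   p = inj₁ p
shift-⊆ zero    A (false ∷ false ∷ x) p = inj₁ p
shift-⊆ zero    A (true ∷ false ∷ x)  p = ∨-elim _ p
shift-⊆ zero    A (false ∷ true ∷ x)  p = inj₁ (proj₂ (∧-elim _ p))
shift-⊆ (suc j) A []                  p = inj₁ p
shift-⊆ (suc j) A (b ∷ x)             p = shift-⊆ j (A ▸ b) x p

shift-⊇ : ∀ {n} j (A : Family n) x → A ∋ x → shift j A ∋ x ⊎ shift j A ∋ swap j x
shift-⊇ zero    A []                  p = inj₁ p
shift-⊇ zero    A (b ∷ [])            p = inj₁ p
shift-⊇ zero    A (true ∷ true ∷ x)   p = inj₁ p
shift-⊇ zero    A (false ∷ false ∷ x) p = inj₁ p
shift-⊇ zero    A (true ∷ false ∷ x)  p = inj₁ (∨-intro₁ p)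
shift-⊇ zero    A (false ∷ true ∷ x)  p = inj₂ (∨-intro₂ _ p)
shift-⊇ (suc j) A []                  p = inj₁ p
shift-⊇ (suc j) A (b ∷ x)             p = shift-⊇ j (A ▸ b) x p

shift-uniform : ∀ {u k n} j {A : Family n} → Uniform u k A → Uniform u k (shift j A)
shift-uniform {u} j {A} U x p with shift-⊆ j A x p
... | inj₁ q = U x q
... | inj₂ q = trans (cong (u +_) (sym (∣swap∣ j x))) (U (swap j x) q)

∪∩-swap : ∀ {n} (A B : Family n) → card (A ∩ᶠ B) + card (A ∪ᶠ B) ≡ card B + card A
∪∩-swap A B = trans (+-comm (card (A ∩ᶠ B)) _) (trans (card-∪∩ A B) (+-comm (card A) _))

card-shift : ∀ {n} j (A : Family n) → card (shift j A) ≡ card A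
card-shift {zero}        zero    A = refl
card-shift {suc zero}    zero    A = refl
card-shift {suc (suc n)} zero    A = begin
  (c₀₀ + card (A₁₀ ∩ᶠ A₀₁)) + (card (A₁₀ ∪ᶠ A₀₁) + c₁₁)
    ≡⟨ regroup c₀₀ (card (A₁₀ ∩ᶠ A₀₁)) (card (A₁₀ ∪ᶠ A₀₁)) c₁₁ ⟩
  c₀₀ + (card (A₁₀ ∩ᶠ A₀₁) + card (A₁₀ ∪ᶠ A₀₁)) + c₁₁
    ≡⟨ cong (λ s → c₀₀ + s + c₁₁) (∪∩-swap A₁₀ A₀₁) ⟩
  c₀₀ + (card A₀₁ + card A₁₀) + c₁₁
    ≡⟨ regroup c₀₀ (card A₀₁) (card A₁₀) c₁₁ ⟨
  (c₀₀ + card A₀₁) + (card A₁₀ + c₁₁) ∎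
  where
  open ≡-Reasoning
  A₁₀ = A ▸ true ▸ false
  A₀₁ = A ▸ false ▸ true
  c₀₀ = card (A ▸ false ▸ false)
  c₁₁ = card (A ▸ true ▸ true)
  regroup : ∀ a b c d → (a + b) + (c + d) ≡ a + (b + c) + d
  regroup = solve 4 (λ a b c d → (a :+ b) :+ (c :+ d) := a :+ (b :+ c) :+ d) refl
    where open +-*-Solver
card-shift {zero}        (suc j) A = refl
card-shift {suc n}       (suc j) A = cong₂ _+_ (card-shift j (A ▸ false)) (card-shift j (A ▸ true))

crossing-▸ : ∀ {n} {A B : Family (suc n)} a b → a ∧ b ≡ false → Crossing A B → Crossing (A ▸ a) (B ▸ b)
crossing-▸ {A = A} {B} a b r X x y p q = trans (cong (_∨ meets x y) (sym r)) (X (a ∷ x) (b ∷ y) p q)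

-- A set `false ∷ true ∷ y` stays only if its swap is present too. So when its partner is new, the
-- partner's original can be crossed with that swap instead, which yields a common point in the
-- tails.
shift-crossing : ∀ {n} j {A B : Family n} → Crossing A B → Crossing (shift j A) (shift j B)
shift-crossing zero    X []       []       p q = X _ _ p q
shift-crossing zero    X (a ∷ []) (b ∷ []) p q = X _ _ p q
shift-crossing zero    X (true ∷ a ∷ x) (true ∷ b ∷ y) p q = refl
shift-crossing zero    X (false ∷ true ∷ x) (a ∷ true ∷ y) p q = refl
shift-crossing zero    X (true ∷ true ∷ x) (false ∷ true ∷ y) p q = refl
shift-crossing zero    X (false ∷ false ∷ x) (false ∷ false ∷ y) p q = X _ _ p q
shift-crossing zero    X (false ∷ false ∷ x) (false ∷ true ∷ y) p q = X _ _ p (proj₂ (∧-elim _ q))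
shift-crossing zero    X (false ∷ false ∷ x) (true ∷ false ∷ y) p q with ∨-elim _ q
... | inj₁ r = X _ _ p r
... | inj₂ r = X _ _ p r
shift-crossing zero    X (false ∷ false ∷ x) (true ∷ true ∷ y) p q = X _ _ p q
shift-crossing zero    X (false ∷ true ∷ x) (false ∷ false ∷ y) p q = X _ _ (proj₂ (∧-elim _ p)) q
shift-crossing zero    X (false ∷ true ∷ x) (true ∷ false ∷ y) p q with ∨-elim _ q
... | inj₁ r = X _ _ (proj₂ (∧-elim _ p)) r
... | inj₂ r = X _ _ (proj₁ (∧-elim _ p)) r
shift-crossing zero    X (true ∷ false ∷ x) (false ∷ false ∷ y) p q with ∨-elim _ p
... | inj₁ r = X _ _ r q
... | inj₂ r = X _ _ r q
shift-crossing zero    X (true ∷ false ∷ x) (false ∷ true ∷ y) p q with ∨-elim _ p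
... | inj₁ r = X _ _ r (proj₂ (∧-elim _ q))
... | inj₂ r = X _ _ r (proj₁ (∧-elim _ q))
shift-crossing zero    X (true ∷ true ∷ x) (false ∷ false ∷ y) p q = X _ _ p q
shift-crossing (suc j) X []      []      p q = X _ _ p q
shift-crossing (suc j) {A} {B} X (true ∷ x)  (true ∷ y)  p q = refl
shift-crossing (suc j) {A} {B} X (true ∷ x)  (false ∷ y) p q = shift-crossing j (crossing-▸ {A = A} {B} true false refl X) x y p q
shift-crossing (suc j) {A} {B} X (false ∷ x) (true ∷ y)  p q = shift-crossing j (crossing-▸ {A = A} {B} false true refl X) x y p q
shift-crossing (suc j) {A} {B} X (false ∷ x) (false ∷ y) p q = shift-crossing j (crossing-▸ {A = A} {B} false false refl X) x y p q

-- Sum, over all members x and all p ∉ x, of the number of elements larger than p.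
potential : ∀ {n} → Family n → ℕ
potential {zero}  A = 0
potential {suc n} A = n * card (A ▸ false) + (potential (A ▸ false) + potential (A ▸ true))

potential-∪∩ : ∀ {n} (A B : Family n) → potential (A ∩ᶠ B) + potential (A ∪ᶠ B) ≡ potential B + potential A
potential-∪∩ {zero}  A B = refl
potential-∪∩ {suc n} A B = begin
  _ ≡⟨ regroup n (card ((A ▸ false) ∩ᶠ (B ▸ false))) (card ((A ▸ false) ∪ᶠ (B ▸ false))) (potential ((A ▸ false) ∩ᶠ (B ▸ false))) _ _ _ ⟩
  _ ≡⟨ cong₂ _+_ (cong (n *_) (∪∩-swap (A ▸ false) (B ▸ false)))
         (cong₂ _+_ (potential-∪∩ (A ▸ false) (B ▸ false)) (potential-∪∩ (A ▸ true) (B ▸ true))) ⟩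
  _ ≡⟨ regroup n (card (B ▸ false)) (card (A ▸ false)) (potential (B ▸ false)) _ _ _ ⟨
  _ ∎
  where
  open ≡-Reasoning
  regroup : ∀ n c c′ a b a′ b′ → (n * c + (a + b)) + (n * c′ + (a′ + b′)) ≡ n * (c + c′) + ((a + a′) + (b + b′))
  regroup = solve 7 (λ n c c′ a b a′ b′ →
    (n :* c :+ (a :+ b)) :+ (n :* c′ :+ (a′ :+ b′)) := n :* (c :+ c′) :+ ((a :+ a′) :+ (b :+ b′))) refl
    where open +-*-Solver

-- The potential drops by one for each set that moves, and a set moves exactly when its swap is
-- missing. Both sides are additive to avoid subtraction.
potential-shift₀ : ∀ {n} (A : Family (2 + n)) →
  potential (shift 0 A) + card (A ▸ false ▸ true) ≡ potential A + card ((A ▸ true ▸ false) ∩ᶠ (A ▸ false ▸ true))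
potential-shift₀ {n} A = begin
  (suc n * (c₀₀ + c∩) + ((n * c₀₀ + (p₀₀ + p∩)) + (n * c∪ + (p∪ + p₁₁)))) + c₀₁
    ≡⟨ regroup n c₀₀ c∩ c∪ c₀₁ p₀₀ p∩ p∪ p₁₁ ⟩
  rest + n * (c∩ + c∪) + (p∩ + p∪) + c₀₁ + c∩
    ≡⟨ cong₂ (λ s t → rest + n * s + t + c₀₁ + c∩) (∪∩-swap A₁₀ A₀₁) (potential-∪∩ A₁₀ A₀₁) ⟩
  rest + n * (c₀₁ + c₁₀) + (p₀₁ + p₁₀) + c₀₁ + c∩
    ≡⟨ cong (_+ c∩) (regroup′ n c₀₀ c₀₁ c₁₀ p₀₀ p₀₁ p₁₀ p₁₁) ⟨
  (suc n * (c₀₀ + c₀₁) + ((n * c₀₀ + (p₀₀ + p₀₁)) + (n * c₁₀ + (p₁₀ + p₁₁)))) + c∩ ∎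
  where
  open ≡-Reasoning
  A₁₀ = A ▸ true ▸ false
  A₀₁ = A ▸ false ▸ true
  c₀₀ = card (A ▸ false ▸ false)
  c₀₁ = card A₀₁
  c₁₀ = card A₁₀
  c∩  = card (A₁₀ ∩ᶠ A₀₁)
  c∪  = card (A₁₀ ∪ᶠ A₀₁)
  p₀₀ = potential (A ▸ false ▸ false)
  p₀₁ = potential A₀₁
  p₁₀ = potential A₁₀
  p₁₁ = potential (A ▸ true ▸ true)
  p∩  = potential (A₁₀ ∩ᶠ A₀₁)
  p∪  = potential (A₁₀ ∪ᶠ A₀₁)
  rest = suc n * c₀₀ + n * c₀₀ + p₀₀ + p₁₁
  open +-*-Solver
  regroup : ∀ n c₀₀ c∩ c∪ c₀₁ p₀₀ p∩ p∪ p₁₁ →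
    (suc n * (c₀₀ + c∩) + ((n * c₀₀ + (p₀₀ + p∩)) + (n * c∪ + (p∪ + p₁₁)))) + c₀₁ ≡
    suc n * c₀₀ + n * c₀₀ + p₀₀ + p₁₁ + n * (c∩ + c∪) + (p∩ + p∪) + c₀₁ + c∩
  regroup = solve 9 (λ n c₀₀ c∩ c∪ c₀₁ p₀₀ p∩ p∪ p₁₁ →
    ((con 1 :+ n) :* (c₀₀ :+ c∩) :+ ((n :* c₀₀ :+ (p₀₀ :+ p∩)) :+ (n :* c∪ :+ (p∪ :+ p₁₁)))) :+ c₀₁ :=
    (con 1 :+ n) :* c₀₀ :+ n :* c₀₀ :+ p₀₀ :+ p₁₁ :+ n :* (c∩ :+ c∪) :+ (p∩ :+ p∪) :+ c₀₁ :+ c∩) refl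
  regroup′ : ∀ n c₀₀ c₀₁ c₁₀ p₀₀ p₀₁ p₁₀ p₁₁ →
    suc n * (c₀₀ + c₀₁) + ((n * c₀₀ + (p₀₀ + p₀₁)) + (n * c₁₀ + (p₁₀ + p₁₁))) ≡
    suc n * c₀₀ + n * c₀₀ + p₀₀ + p₁₁ + n * (c₀₁ + c₁₀) + (p₀₁ + p₁₀) + c₀₁
  regroup′ = solve 8 (λ n c₀₀ c₀₁ c₁₀ p₀₀ p₀₁ p₁₀ p₁₁ →
    (con 1 :+ n) :* (c₀₀ :+ c₀₁) :+ ((n :* c₀₀ :+ (p₀₀ :+ p₀₁)) :+ (n :* c₁₀ :+ (p₁₀ :+ p₁₁))) :=
    (con 1 :+ n) :* c₀₀ :+ n :* c₀₀ :+ p₀₀ :+ p₁₁ :+ n :* (c₀₁ :+ c₁₀) :+ (p₀₁ :+ p₁₀) :+ c₀₁) refl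

∩-⊑ : ∀ {n} (A B : Family n) → (A ∩ᶠ B) ⊑ B
∩-⊑ A B x p = proj₂ (∧-elim _ p)

potential-shift-≤ : ∀ {n} j (A : Family n) → potential (shift j A) ≤ potential A
potential-shift-≤ {zero}        zero    A = ≤-refl
potential-shift-≤ {suc zero}    zero    A = ≤-refl
potential-shift-≤ {suc (suc n)} zero    A = +-cancelʳ-≤ (card (A ▸ false ▸ true)) _ _
  (≤-trans (≤-reflexive (potential-shift₀ A))
           (+-monoʳ-≤ (potential A) (card-mono (∩-⊑ (A ▸ true ▸ false) (A ▸ false ▸ true)))))
potential-shift-≤ {zero}        (suc j) A = ≤-refl
potential-shift-≤ {suc n}       (suc j) A rewrite card-shift j (A ▸ false) =
  +-monoʳ-≤ (n * card (A ▸ false)) (+-mono-≤ (potential-shift-≤ j (A ▸ false)) (potential-shift-≤ j (A ▸ true)))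

lower : ∀ {n} → ℕ → Subset n → Subset n
lower zero    []                = []
lower zero    (b ∷ [])          = b ∷ []
lower zero    (false ∷ true ∷ x) = true ∷ false ∷ x
lower zero    (false ∷ false ∷ x) = false ∷ false ∷ x
lower zero    (true ∷ b ∷ x)    = true ∷ b ∷ x
lower (suc j) []                = []
lower (suc j) (b ∷ x)           = b ∷ lower j x

Shifted : ∀ {n} → Family n → Set
Shifted A = ∀ j x → A ∋ x → A ∋ lower j x

search : ∀ {n} (A : Family n) → (∃[ x ] A ∋ x) ⊎ (∀ x → A x ≡ false)
search {zero} A with A [] in eq
... | true  = inj₁ ([] , eq)
... | false = inj₂ λ { [] → eq }
search {suc n} A with search (A ▸ false) | search (A ▸ true)
... | inj₁ (x , p) | _            = inj₁ (_ , p)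
... | inj₂ _       | inj₁ (x , p) = inj₁ (_ , p)
... | inj₂ f       | inj₂ t       = inj₂ λ { (false ∷ x) → f x ; (true ∷ x) → t x }

-- If some `false ∷ true ∷ x` lies in the family without its swap, the shift at 0 moves it and the
-- potential drops strictly. Otherwise position 0 is stable and the two slices decide the remaining
-- positions.
shifted? : ∀ {n} (A : Family n) → Shifted A ⊎ ∃[ j ] potential (shift j A) < potential A
shifted? {zero}     A = inj₁ λ { zero [] p → p ; (suc j) [] p → p }
shifted? {suc zero} A = inj₁ λ { zero (b ∷ []) p → p ; (suc zero) (b ∷ []) p → p ; (suc (suc j)) (b ∷ []) p → p }
shifted? {suc (suc n)} A
  with search (λ x → A (false ∷ true ∷ x) ∧ not (A (true ∷ false ∷ x)))
     | shifted? (A ▸ false) | shifted? (A ▸ true)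
... | inj₁ (x , p) | _ | _ = inj₂ (0 , +-cancelʳ-< (card (A ▸ false ▸ true)) _ _
        (subst (_< potential A + card (A ▸ false ▸ true)) (sym (potential-shift₀ A))
          (+-monoʳ-< (potential A) (card-mono-< (∩-⊑ (A ▸ true ▸ false) (A ▸ false ▸ true)) x
            (avoid (A (true ∷ false ∷ x)) _ (proj₂ (∧-elim _ p))) (proj₁ (∧-elim _ p))))))
  where
  avoid : ∀ a b → not a ≡ true → a ∧ b ≡ false
  avoid false b p = refl
... | inj₂ _ | inj₂ (j , lt) | _ = inj₂ (suc j , lemma)
  where
  lemma : potential (shift (suc j) A) < potential A
  lemma rewrite card-shift j (A ▸ false) = +-monoʳ-< (suc n * card (A ▸ false)) (+-mono-<-≤ lt (potential-shift-≤ j (A ▸ true)))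
... | inj₂ _ | inj₁ _ | inj₂ (j , lt) = inj₂ (suc j , lemma)
  where
  lemma : potential (shift (suc j) A) < potential A
  lemma rewrite card-shift j (A ▸ false) = +-monoʳ-< (suc n * card (A ▸ false)) (+-mono-≤-< (potential-shift-≤ j (A ▸ false)) lt)
... | inj₂ none | inj₁ S₀ | inj₁ S₁ = inj₁ S
  where
  S : Shifted A
  S zero (false ∷ true ∷ x) p with A (true ∷ false ∷ x) | none x
  ... | true  | _ = refl
  ... | false | q rewrite p = ⊥-elim (false≢true (sym q))
  S zero (false ∷ false ∷ x) p = p
  S zero (true ∷ b ∷ x) p = p
  S (suc j) (false ∷ x) p = S₀ j x p
  S (suc j) (true ∷ x) p = S₁ j x p

-- Walks of shifted cross-intersecting families

-- Lists rather than vectors, so that free slots can be prepended without length transports.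
Closed : (List Bool → Set) → Set
Closed P = ∀ xs ys → P (xs ++ false ∷ true ∷ ys) → P (xs ++ true ∷ false ∷ ys)

data Disjoint : List Bool → List Bool → Set where
  []  : Disjoint [] []
  _∷_ : ∀ {a b xs ys} → a ∧ b ≡ false → Disjoint xs ys → Disjoint (a ∷ xs) (b ∷ ys)

Apart : (List Bool → Set) → (List Bool → Set) → Set
Apart P Q = ∀ {xs ys} → P xs → Q ys → ¬ Disjoint xs ys

closed-∷ : ∀ {P} b → Closed P → Closed (λ xs → P (b ∷ xs))
closed-∷ b cl xs = cl (b ∷ xs)

pull : ∀ {P} → Closed P → ∀ c xs → P (replicate c false ++ true ∷ xs) → P (true ∷ replicate c false ++ xs)
pull cl zero    xs p = p
pull {P} cl (suc c) xs p = cl [] (replicate c false ++ xs) (pull {λ ys → P (false ∷ ys)} (closed-∷ {P} false cl) c xs p)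

-- The two lists are equal, but not by computation for a variable `c`.
push : ∀ {P : List Bool → Set} c xs → P (replicate c false ++ false ∷ xs) → P (false ∷ replicate c false ++ xs)
push zero    xs p = p
push {P} (suc c) xs p = push {λ ys → P (false ∷ ys)} c xs p

zeros-disjoint : ∀ c → Disjoint (replicate c false ++ []) (replicate c false ++ [])
zeros-disjoint zero    = []
zeros-disjoint (suc c) = refl ∷ zeros-disjoint c

-- Read x and y from left to right, with c counting the positions in neither that are still unused.
-- A common element of x and y is moved, in x, to an unused position; u + v ≡ 2c + 3 is invariant
-- and keeps one available, so x and y can be made disjoint.
walks : ∀ {n} {P Q : List Bool → Set} → Closed P → Closed Q → Apart P Q →
  ∀ c u v (x y : Subset n) → u + v ≡ 3 + (c + c) → hits u x ≡ false → hits v y ≡ false →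
  P (replicate c false ++ toList x) → Q (replicate c false ++ toList y) → ⊥
-- The remaining heights are positive in every clause, because `hits zero` is always `true`.
walks clP clQ ap c (suc u) (suc v) [] [] e hx hy p q = ap p q (zeros-disjoint c)
walks {P = P} {Q} clP clQ ap c (suc u) (suc v) (false ∷ x) (false ∷ y) e hx hy p q =
  walks clP clQ ap (suc c) (2 + u) (2 + v) x y e′ hx hy (push {P} c _ p) (push {Q} c _ q)
  where
  e′ : 2 + u + (2 + v) ≡ 3 + (suc c + suc c)
  e′ = trans (solve 2 (λ u v → con 2 :+ u :+ (con 2 :+ v) := con 2 :+ (con 1 :+ u :+ (con 1 :+ v))) refl u v)
             (trans (cong (2 +_) e) (solve 1 (λ c → con 2 :+ (con 3 :+ (c :+ c)) := con 3 :+ (con 1 :+ c :+ (con 1 :+ c))) refl c))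
    where open +-*-Solver
walks {P = P} {Q} clP clQ ap c (suc u) (suc v) (true ∷ x) (false ∷ y) e hx hy p q =
  walks {P = λ xs → P (true ∷ xs)} {λ ys → Q (false ∷ ys)}
    (closed-∷ {P} true clP) (closed-∷ {Q} false clQ) (λ p q d → ap p q (refl ∷ d))
    c u (2 + v) x y (trans (+-suc u (suc v)) e) hx hy (pull {P} clP c _ p) (push {Q} c _ q)
walks {P = P} {Q} clP clQ ap c (suc u) (suc v) (false ∷ x) (true ∷ y) e hx hy p q =
  walks {P = λ xs → P (false ∷ xs)} {λ ys → Q (true ∷ ys)}
    (closed-∷ {P} false clP) (closed-∷ {Q} true clQ) (λ p q d → ap p q (refl ∷ d))
    c (2 + u) v x y (trans (cong suc (sym (+-suc u v))) e) hx hy (push {P} c _ p) (pull {Q} clQ c _ q)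
-- Height 1 would be reached by this up step, so both heights are at least 2, which contradicts
-- their sum being 3.
walks clP clQ ap zero (suc (suc u)) (suc (suc v)) (true ∷ x) (true ∷ y) e hx hy p q
  rewrite +-suc u (suc v) | +-suc u v with e
... | ()
-- The element of `x` goes to the first slot and that of `y` to the second. Two of the `2 + c`
-- available positions are spent, and both heights fall by one.
walks {P = P} {Q} clP clQ ap (suc c) (suc u) (suc v) (true ∷ x) (true ∷ y) e hx hy p q =
  walks {P = λ xs → P (true ∷ false ∷ xs)} {λ ys → Q (false ∷ true ∷ ys)}
    (λ xs → clP (true ∷ false ∷ xs)) (λ ys → clQ (false ∷ true ∷ ys)) (λ p q d → ap p q (refl ∷ refl ∷ d))
    c u v x y e′ hx hy (pull {P} clP (suc c) _ p) (pull {λ ys → Q (false ∷ ys)} (closed-∷ {Q} false clQ) c _ q)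
  where
  e′ : u + v ≡ 3 + (c + c)
  e′ = suc-injective (suc-injective (trans (cong suc (sym (+-suc u v)))
         (trans e (cong (λ s → 4 + s) (+-suc c c)))))

Listed : ∀ {n} → Family n → List Bool → Set
Listed {n} A l = ∃[ x ] (toList x ≡ l × A ∋ x)

toList-lower : ∀ {n} (x : Subset n) xs ys → toList x ≡ xs ++ false ∷ true ∷ ys →
  toList (lower (length xs) x) ≡ xs ++ true ∷ false ∷ ys
toList-lower (false ∷ true ∷ x) [] .(toList x) refl = refl
toList-lower (b ∷ x) (c ∷ xs) ys e = cong₂ _∷_ (proj₁ (∷-injective e)) (toList-lower x xs ys (proj₂ (∷-injective e)))

listed-closed : ∀ {n} {A : Family n} → Shifted A → Closed (Listed A)
listed-closed S xs ys (x , e , p) = lower (length xs) x , toList-lower x xs ys e , S (length xs) x p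

disjoint⇒¬meets : ∀ {n} (x y : Subset n) → Disjoint (toList x) (toList y) → meets x y ≡ false
disjoint⇒¬meets []      []      []      = refl
disjoint⇒¬meets (a ∷ x) (b ∷ y) (r ∷ d) rewrite r = disjoint⇒¬meets x y d

shifted-hits : ∀ {n} {A B : Family n} → Shifted A → Shifted B → Crossing A B →
  ∀ u v x y → u + v ≡ 3 → A ∋ x → B ∋ y → hits u x ≡ false → hits v y ≡ false → ⊥
shifted-hits {A = A} {B} SA SB X u v x y e p q hx hy =
  walks {P = Listed A} {Listed B} (listed-closed SA) (listed-closed SB) apart 0 u v x y e hx hy (x , refl , p) (y , refl , q)
  where
  apart : Apart (Listed A) (Listed B)
  apart (x , refl , p) (y , refl , q) d = false≢true (trans (sym (disjoint⇒¬meets x y d)) (X x y p q))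

-- Common stars

⊑? : ∀ {n} (A B : Family n) → A ⊑ B ⊎ ∃[ x ] (A ∋ x × B x ≡ false)
⊑? A B with search (λ x → A x ∧ not (B x))
... | inj₁ (x , p) with A x in eq | B x in eq′
...   | true | false = inj₂ (x , eq , eq′)
⊑? A B | inj₂ none = inj₁ sub
  where
  sub : A ⊑ B
  sub x p with B x | none x
  ... | true  | _ = refl
  ... | false | q rewrite p = ⊥-elim (false≢true (sym q))

meets-sym : ∀ {n} (x y : Subset n) → meets x y ≡ meets y x
meets-sym []          []          = refl
meets-sym (true ∷ x)  (true ∷ y)  = refl
meets-sym (true ∷ x)  (false ∷ y) = meets-sym x y
meets-sym (false ∷ x) (true ∷ y)  = meets-sym x y
meets-sym (false ∷ x) (false ∷ y) = meets-sym x y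

crossing-sym : ∀ {n} {A B : Family n} → Crossing A B → Crossing B A
crossing-sym X x y p q = trans (meets-sym x y) (X y x q p)

star : ∀ {n} → Fin n → Family n
star p x = lookup x p

-- On `2 + n` points, the first summand bounds the members of A through a point that some member of
-- B avoids; the second bounds the members off the first point when all walks reach height 1.
threshold : ℕ → ℕ → ℕ
threshold n k = k * choose n 2 k + choose (suc n) 2 k

shifted-star : ∀ {n k} {A B : Family (2 + n)} → Uniform 0 k A → Uniform 0 k B →
  Shifted A → Shifted B → Crossing A B → choose (2 + n) 2 k ≤ threshold n k →
  threshold n k < card A → threshold n k < card B → B ⊑ star zero
shifted-star UA UB SA SB X le la lb (true ∷ y) q = refl
shifted-star {n} {k} {A} {B} UA UB SA SB X le la lb (false ∷ y) q = ⊥-elim (<⇒≱ la bound)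
  where
  -- A walk of `A` below height 1 would force every walk of `B` to height 2, making `B` too small.
  high : ∀ x → A ∋ x → hits 1 x ≡ true
  high x p with hits 1 x in eq
  ... | true  = refl
  ... | false = ⊥-elim (<⇒≱ lb (≤-trans (card-hits 2 UB all) le))
    where
    all : ∀ y → B ∋ y → hits 2 y ≡ true
    all y q with hits 2 y in eq′
    ... | true  = refl
    ... | false = ⊥-elim (shifted-hits SA SB X 1 2 x y refl p q eq eq′)
  bound : card A ≤ threshold n k
  bound = begin
    card (A ▸ false) + card (A ▸ true)
      -- A walk that starts with a down step needs height 2 from its tail; a member with the first
      -- point must meet `false ∷ y` inside `y`.
      ≤⟨ +-mono-≤ (card-hits 2 (uniform-▸false UA) (λ x → high (false ∷ x)))
                  (card-meeting (uniform-▸true UA) y (λ x p → X (true ∷ x) (false ∷ y) p q)) ⟩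
    choose (suc n) 2 k + ∣ y ∣ * choose n 2 k
      ≡⟨ cong (λ s → choose (suc n) 2 k + s * choose n 2 k) (UB (false ∷ y) q) ⟩
    choose (suc n) 2 k + k * choose n 2 k
      ≡⟨ +-comm (choose (suc n) 2 k) _ ⟩
    threshold n k ∎
    where open ≤-Reasoning

card-∩-star : ∀ {n k} {A B : Family (2 + n)} → Uniform 0 k A → Uniform 0 k B → Crossing A B →
  ∀ p b → B ∋ b → lookup b p ≡ false → card (A ∩ᶠ star p) ≤ k * choose n 2 k
card-∩-star {n} {k} {A} UA UB X p b q r =
  subst (λ s → card (A ∩ᶠ star p) ≤ s * choose n 2 k) (UB b q)
    (card-star-meeting (λ x m → UA x (proj₁ (∧-elim _ m))) p b r
      (λ x m → proj₂ (∧-elim (A x) m)) (λ x m → X x b (proj₁ (∧-elim _ m)) q))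

⊑-∩ : ∀ {n} {A B : Family n} → A ⊑ B → A ⊑ (A ∩ᶠ B)
⊑-∩ h x p rewrite p = h x p

-- A member of `B` off `p` would leave at most kD members in `A`, all of which contain `p`.
star-transfer : ∀ {n k} {A B : Family (2 + n)} → Uniform 0 k A → Uniform 0 k B → Crossing A B →
  threshold n k < card A → ∀ p → A ⊑ star p → B ⊑ star p
star-transfer {n} {k} {A} {B} UA UB X la p h with ⊑? B (star p)
... | inj₁ s = s
... | inj₂ (b , q , r) = ⊥-elim (<⇒≱ la (begin
  card A                 ≤⟨ card-mono (⊑-∩ h) ⟩
  card (A ∩ᶠ star p)     ≤⟨ card-∩-star UA UB X p b q r ⟩
  k * choose n 2 k       ≤⟨ m≤m+n _ _ ⟩
  threshold n k          ∎))
  where open ≤-Reasoning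

two-cover-card : ∀ {n k} {A B : Family (2 + n)} → Uniform 0 k A → Uniform 0 k B → Crossing A B →
  ∀ p q → A ⊑ (star p ∪ᶠ star q) → ∀ b b′ → B ∋ b → B ∋ b′ → lookup b p ≡ false → lookup b′ q ≡ false →
  card A ≤ 2 * (k * choose n 2 k)
two-cover-card {n} {k} {A} {B} UA UB X p q h b b′ m m′ r r′ = begin
  card A                                     ≤⟨ card-∪-≤ split ⟩
  card (A ∩ᶠ star p) + card (A ∩ᶠ star q)    ≤⟨ +-mono-≤ (card-∩-star UA UB X p b m r) (card-∩-star UA UB X q b′ m′ r′) ⟩
  kD + kD                                    ≡⟨ cong (kD +_) (+-identityʳ kD) ⟨
  2 * kD                                     ∎
  where
  open ≤-Reasoning
  kD = k * choose n 2 k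
  split : ∀ x → A ∋ x → (A ∩ᶠ star p) ∋ x ⊎ (A ∩ᶠ star q) ∋ x
  split x m rewrite m = ∨-elim (lookup x p) (h x m)

CommonStar : ∀ {n} → Family n → Family n → Set
CommonStar A B = ∃[ p ] (A ⊑ star p × B ⊑ star p)

-- If one family lies in the star of `p` or of `q`, the other follows by `star-transfer`. Otherwise
-- each family has members avoiding `p` and members avoiding `q`, so each has at most 2kD members.
two-cover-star : ∀ {n k} {A B : Family (2 + n)} → Uniform 0 k A → Uniform 0 k B → Crossing A B →
  threshold n k < card A → threshold n k < card B → 4 * (k * choose n 2 k) < card A + card B →
  ∀ p q → A ⊑ (star p ∪ᶠ star q) → B ⊑ (star p ∪ᶠ star q) → CommonStar A B
two-cover-star {n} {k} {A} {B} UA UB X la lb lab p q hA hB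
  with ⊑? A (star p) | ⊑? A (star q) | ⊑? B (star p) | ⊑? B (star q)
... | inj₁ s | _ | _ | _ = p , s , star-transfer UA UB X la p s
... | inj₂ _ | inj₁ s | _ | _ = q , s , star-transfer UA UB X la q s
... | inj₂ _ | inj₂ _ | inj₁ s | _ = p , star-transfer UB UA (crossing-sym {A = A} {B} X) lb p s , s
... | inj₂ _ | inj₂ _ | inj₂ _ | inj₁ s = q , star-transfer UB UA (crossing-sym {A = A} {B} X) lb q s , s
... | inj₂ (a , m , r) | inj₂ (a′ , m′ , r′) | inj₂ (b , l , t) | inj₂ (b′ , l′ , t′) =
  ⊥-elim (<⇒≱ lab (begin
    card A + card B      ≤⟨ +-mono-≤ (two-cover-card UA UB X p q hA b b′ l l′ t t′)
                                     (two-cover-card UB UA (crossing-sym {A = A} {B} X) p q hB a a′ m m′ r r′) ⟩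
    2 * kD + 2 * kD      ≡⟨ *-distribʳ-+ kD 2 2 ⟨
    4 * kD               ∎))
  where
  open ≤-Reasoning
  kD = k * choose n 2 k

-- Of each original member, either the set itself or its swap survives the shift and contains `p`.
unshift-star : ∀ {n} j {A : Family n} p → shift j A ⊑ star p → A ⊑ (star p ∪ᶠ star (swapᶠ j p))
unshift-star j {A} p h x m with shift-⊇ j A x m
... | inj₁ s = ∨-intro₁ (h x s)
... | inj₂ s = ∨-intro₂ (lookup x p) (trans (sym (lookup-swap j x p)) (h (swap j x) s))

-- Induction on the total potential. Both families are shifted at the same position, which keeps
-- them crossing; a star found after the shift becomes a two-point cover before it.
common-star : ∀ {n k} → choose (2 + n) 2 k ≤ threshold n k → (A B : Family (2 + n)) →
  Uniform 0 k A → Uniform 0 k B → Crossing A B →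
  threshold n k < card A → threshold n k < card B → 4 * (k * choose n 2 k) < card A + card B →
  CommonStar A B
common-star {n} {k} le A B = compress A B (<-wellFounded _)
  where
  compress : ∀ A B → Acc _<_ (potential A + potential B) → Uniform 0 k A → Uniform 0 k B → Crossing A B →
    threshold n k < card A → threshold n k < card B → 4 * (k * choose n 2 k) < card A + card B → CommonStar A B
  compress A B (acc rec) UA UB X la lb lab = by-cases (shifted? A) (shifted? B)
    where
    after : ∀ j → potential (shift j A) + potential (shift j B) < potential A + potential B → CommonStar A B
    after j lt =
      let p , sA , sB = compress (shift j A) (shift j B) (rec lt)
                          (shift-uniform j UA) (shift-uniform j UB) (shift-crossing j {A} {B} X)
                          (subst (threshold n k <_) (sym (card-shift j A)) la)
                          (subst (threshold n k <_) (sym (card-shift j B)) lb)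
                          (subst₂ (λ s t → 4 * (k * choose n 2 k) < s + t) (sym (card-shift j A)) (sym (card-shift j B)) lab)
      in two-cover-star UA UB X la lb lab p (swapᶠ j p) (unshift-star j p sA) (unshift-star j p sB)
    by-cases : Shifted A ⊎ ∃[ j ] potential (shift j A) < potential A →
               Shifted B ⊎ ∃[ j ] potential (shift j B) < potential B → CommonStar A B
    by-cases (inj₂ (j , lt)) _ = after j (+-mono-<-≤ lt (potential-shift-≤ j B))
    by-cases (inj₁ _) (inj₂ (j , lt)) = after j (+-mono-≤-< (potential-shift-≤ j A) lt)
    by-cases (inj₁ SA) (inj₁ SB) = zero ,
      shifted-star UB UA SB SA (crossing-sym {A = A} {B} X) le lb la ,
      shifted-star UA UB SA SB X le la lb

-- Estimates for binomial coefficients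

C-absorb : ∀ n k → suc k * (suc n C suc k) ≡ suc n * (n C k)
C-absorb n zero = begin
  1 * (suc n C 1)      ≡⟨ *-identityˡ _ ⟩
  suc n C 1            ≡⟨ nC1≡n (suc n) ⟩
  suc n                ≡⟨ *-identityʳ (suc n) ⟨
  suc n * 1            ≡⟨ cong (suc n *_) (nC0≡1 n) ⟨
  suc n * (n C 0)      ∎
  where open ≡-Reasoning
C-absorb zero (suc k) = *-zeroʳ (2 + k)
C-absorb (suc n) (suc k) = begin
  (2 + k) * (suc (suc n) C suc (suc k))                 ≡⟨ cong ((2 + k) *_) (nCk+nC[k+1]≡[n+1]C[k+1] (suc n) (suc k)) ⟨
  (2 + k) * (P + (suc n C suc (suc k)))                 ≡⟨ *-distribˡ-+ (2 + k) P _ ⟩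
  (2 + k) * P + (2 + k) * (suc n C suc (suc k))         ≡⟨ cong₂ (λ s t → P + s + t) (C-absorb n k) (C-absorb n (suc k)) ⟩
  P + suc n * (n C k) + suc n * (n C suc k)             ≡⟨ +-assoc P _ _ ⟩
  P + (suc n * (n C k) + suc n * (n C suc k))           ≡⟨ cong (P +_) (*-distribˡ-+ (suc n) (n C k) _) ⟨
  P + suc n * ((n C k) + (n C suc k))                   ≡⟨ cong (λ s → P + suc n * s) (nCk+nC[k+1]≡[n+1]C[k+1] n k) ⟩
  (2 + n) * P                                           ∎
  where
  open ≡-Reasoning
  P = suc n C suc k

-- The ratio of consecutive binomial coefficients, written without the difference n - k.
C-step : ∀ n k → suc k * (n C suc k) + k * (n C k) ≡ n * (n C k)
C-step n k = +-cancelˡ-≡ (n C k) _ _ (begin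
  c + (suc k * c′ + k * c)     ≡⟨ solve 3 (λ c c′ k → c :+ ((con 1 :+ k) :* c′ :+ k :* c) := (con 1 :+ k) :* (c :+ c′)) refl c c′ k ⟩
  suc k * (c + c′)             ≡⟨ cong (suc k *_) (nCk+nC[k+1]≡[n+1]C[k+1] n k) ⟩
  suc k * (suc n C suc k)      ≡⟨ C-absorb n k ⟩
  suc n * c                    ∎)
  where
  open ≡-Reasoning
  open +-*-Solver
  c = n C k
  c′ = n C suc k

C-mono : ∀ n k → 2 * suc k ≤ n → n C k ≤ n C suc k
C-mono n k h = *-cancelˡ-≤ (suc k) (+-cancelʳ-≤ (k * (n C k)) _ _ (begin
  suc k * (n C k) + k * (n C k)        ≡⟨ *-distribʳ-+ (n C k) (suc k) k ⟨
  (suc k + k) * (n C k)                ≤⟨ *-monoˡ-≤ (n C k) (≤-trans (+-monoʳ-≤ (suc k) (≤-trans (n≤1+n k) (≤-reflexive (sym (+-identityʳ (suc k)))))) h) ⟩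
  n * (n C k)                          ≡⟨ C-step n k ⟨
  suc k * (n C suc k) + k * (n C k)    ∎))
  where open ≤-Reasoning

choose-antitone : ∀ n u k → 2 * k ≤ n → choose n (suc u) k ≤ choose n u k
choose-antitone n u       zero    h = z≤n
choose-antitone n zero    (suc k) h = C-mono n k h
choose-antitone n (suc u) (suc k) h =
  choose-antitone n u k (≤-trans (*-monoʳ-≤ 2 (n≤1+n k)) h)

-- Two uses of Pascal's rule leave `choose (1 + n) 2 k` and two terms of size at most D; since k ≥ 2
-- here, kD absorbs these.
choose≤threshold : ∀ n k → 2 * k ≤ n → choose (2 + n) 2 k ≤ threshold n k
choose≤threshold n zero    h = z≤n
choose≤threshold n (suc zero) h = z≤n
choose≤threshold n k@(suc (suc j)) h = begin
  choose (2 + n) 2 k                                      ≡⟨ choose-pascal (1 + n) 2 k ⟩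
  choose (1 + n) 2 k + choose (1 + n) 3 k                 ≡⟨ cong (choose (1 + n) 2 k +_) (choose-pascal n 3 k) ⟩
  choose (1 + n) 2 k + (choose n 3 k + choose n 4 k)      ≤⟨ +-monoʳ-≤ (choose (1 + n) 2 k) (+-mono-≤ c₃ (≤-trans (choose-antitone n 3 k h) c₃)) ⟩
  choose (1 + n) 2 k + (D + D)                            ≡⟨ +-comm (choose (1 + n) 2 k) _ ⟩
  D + D + choose (1 + n) 2 k                              ≤⟨ +-monoˡ-≤ (choose (1 + n) 2 k) (+-monoʳ-≤ D (m≤m+n D (j * D))) ⟩
  threshold n k                                           ∎
  where
  open ≤-Reasoning
  D = choose n 2 k
  c₃ : choose n 3 k ≤ D
  c₃ = choose-antitone n 2 k h

-- For `j = suc i`, `C-step` expands the left side and leaves `i * c ≤ D` to prove; `C-step` gives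
-- that as well, because i(i + 2) ≤ n.
E-bound : ∀ n j → (3 + 2 * j) * (3 + 2 * j) ≤ n → choose n 1 j * n ≤ suc j * (n C j)
E-bound n zero    big = z≤n
E-bound n (suc i) big = begin
  c * n                  ≡⟨ *-comm c n ⟩
  n * c                  ≡⟨ C-step n i ⟨
  suc i * D + i * c      ≤⟨ +-monoʳ-≤ (suc i * D) ic≤D ⟩
  suc i * D + D          ≡⟨ +-comm (suc i * D) D ⟩
  (2 + i) * D            ∎
  where
  open ≤-Reasoning
  open +-*-Solver
  c = n C i
  D = n C suc i
  ic≤D : i * c ≤ D
  ic≤D = *-cancelˡ-≤ (suc i) (+-cancelʳ-≤ (i * c) _ _ (begin
    suc i * (i * c) + i * c     ≡⟨ solve 2 (λ i c → (con 1 :+ i) :* (i :* c) :+ i :* c := (i :* (con 2 :+ i)) :* c) refl i c ⟩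
    i * (2 + i) * c             ≤⟨ *-monoˡ-≤ c (≤-trans (*-mono-≤ i≤ i+2≤) big) ⟩
    n * c                       ≡⟨ C-step n i ⟨
    suc i * D + i * c           ∎))
    where
    i≤2i : suc i ≤ 2 * suc i
    i≤2i = m≤m+n (suc i) _
    i+2≤ : 2 + i ≤ 3 + 2 * suc i
    i+2≤ = +-mono-≤ {1} {3} (s≤s z≤n) i≤2i
    i≤ : i ≤ 3 + 2 * suc i
    i≤ = ≤-trans (m≤n+m i 2) i+2≤

-- With k = 2 + j and a ground set of n + 2 points, `big` says (2k - 1)² ≤ n, which is the bound 4k²
-- - 4k + 3 on the ground set.
module _ (n j : ℕ) (big : (3 + 2 * j) * (3 + 2 * j) ≤ n) where

  private
    k = 2 + j
    D = n C j
    S = suc n C suc j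
    E = choose n 1 j

  -- By absorption (k - 1)S = (n + 1)D, and 4k(k - 1) is one less than (2k - 1)².
  4kD≤S : 4 * (k * D) ≤ S
  4kD≤S = *-cancelˡ-≤ (suc j) (begin
    suc j * (4 * (k * D))      ≡⟨ solve 2 (λ j D → (con 1 :+ j) :* (con 4 :* ((con 2 :+ j) :* D)) := (con 4 :* ((con 1 :+ j) :* (con 2 :+ j))) :* D) refl j D ⟩
    4 * (suc j * k) * D        ≤⟨ *-monoˡ-≤ D (≤-trans (m≤m+n _ 1) (≤-trans (≤-reflexive square) (m≤n⇒m≤1+n big))) ⟩
    suc n * D                  ≡⟨ C-absorb n j ⟨
    suc j * S                  ∎)
    where
    open ≤-Reasoning
    open +-*-Solver
    square : 4 * (suc j * k) + 1 ≡ (3 + 2 * j) * (3 + 2 * j)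
    square = solve 1 (λ j → con 4 :* ((con 1 :+ j) :* (con 2 :+ j)) :+ con 1 := (con 3 :+ con 2 :* j) :* (con 3 :+ con 2 :* j)) refl j

  -- The threshold is (k + 1)D + E, and n times E costs at most (k + 1)D more. By absorption the
  -- right side equals (k² - 1)S.
  threshold-bound : threshold n k * n ≤ (3 + j) * (suc n * D)
  threshold-bound = begin
    (k * D + (suc n C j)) * n        ≡⟨ cong (λ s → (k * D + s) * n) (choose-pascal n 0 j) ⟩
    (k * D + (D + E)) * n            ≡⟨ solve 4 (λ j D E n → ((con 2 :+ j) :* D :+ (D :+ E)) :* n := (con 3 :+ j) :* (n :* D) :+ E :* n) refl j D E n ⟩
    (3 + j) * (n * D) + E * n        ≤⟨ +-monoʳ-≤ _ (≤-trans (E-bound n j big) (*-monoˡ-≤ D (m≤n+m (suc j) 2))) ⟩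
    (3 + j) * (n * D) + (3 + j) * D  ≡⟨ solve 3 (λ j D n → (con 3 :+ j) :* (n :* D) :+ (con 3 :+ j) :* D := (con 3 :+ j) :* ((con 1 :+ n) :* D)) refl j D n ⟩
    (3 + j) * (suc n * D)            ∎
    where
    open ≤-Reasoning
    open +-*-Solver

  -- Here `e` over `d` stands for 1 - p and the first hypothesis says k² - 1 ≤ (1 - p)n. Hence the
  -- threshold is at most (1 - p)S.
  threshold-< : ∀ d e a → k * k * d ≤ n * e + d → e * S < d * a → threshold n k < a
  -- The factor `suc j * n` supplies the `n` of `threshold-bound` and the `suc j` of `C-absorb`.
  threshold-< d e a pn lt = ≰⇒> λ a≤T → <⇒≱ (*-monoˡ-< (suc j * n) {{m*n≢0 (suc j) n {{_}} {{>-nonZero n>0}}}} lt) (begin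
    d * a * (suc j * n)                    ≡⟨ solve 4 (λ d a j n → d :* a :* ((con 1 :+ j) :* n) := d :* (con 1 :+ j) :* (a :* n)) refl d a j n ⟩
    d * suc j * (a * n)                    ≤⟨ *-monoʳ-≤ (d * suc j) (≤-trans (*-monoˡ-≤ n a≤T) threshold-bound) ⟩
    d * suc j * ((3 + j) * (suc n * D))    ≡⟨ *-assoc (d * suc j) (3 + j) _ ⟨
    d * suc j * (3 + j) * (suc n * D)      ≤⟨ *-monoˡ-≤ (suc n * D) ne ⟩
    n * e * (suc n * D)                    ≡⟨ cong (n * e *_) (C-absorb n j) ⟨
    n * e * (suc j * S)                    ≡⟨ solve 4 (λ n e j S → n :* e :* ((con 1 :+ j) :* S) := e :* S :* ((con 1 :+ j) :* n)) refl n e j S ⟩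
    e * S * (suc j * n)                    ∎)
    where
    open ≤-Reasoning
    open +-*-Solver
    n>0 : 0 < n
    n>0 = ≤-trans (s≤s z≤n) big
    ne : d * suc j * (3 + j) ≤ n * e
    ne = +-cancelʳ-≤ d _ _ (≤-trans (≤-reflexive
      (solve 2 (λ d j → d :* (con 1 :+ j) :* (con 3 :+ j) :+ d := (con 2 :+ j) :* (con 2 :+ j) :* d) refl d j)) pn)

-- Splitting the colour classes

count : ∀ {m} → (Fin m → Bool) → ℕ
count {zero}  h = 0
count {suc m} h = ind (h zero) + count (h ∘ suc)

count-cong : ∀ {m} {g h : Fin m → Bool} → (∀ i → g i ≡ h i) → count g ≡ count h
count-cong {zero}  e = refl
count-cong {suc m} e = cong₂ _+_ (cong ind (e zero)) (count-cong (e ∘ suc))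

count-false : ∀ m → count {m} (λ _ → false) ≡ 0
count-false zero    = refl
count-false (suc m) = count-false m

count-true : ∀ m → count {m} (λ _ → true) ≡ m
count-true zero    = refl
count-true (suc m) = cong suc (count-true m)

count-+ : ∀ {m} (f g h : Fin m → Bool) → (∀ i → ind (f i) + ind (g i) ≡ ind (h i)) → count f + count g ≡ count h
count-+ {zero}  f g h e = refl
count-+ {suc m} f g h e = trans (swap-mid (ind (f zero)) _ (ind (g zero)) _)
  (cong₂ _+_ (e zero) (count-+ (f ∘ suc) (g ∘ suc) (h ∘ suc) (e ∘ suc)))

length-filter-tabulate : ∀ {m} {A : Set} {P : A → Set} (P? : Decidable P) (f : Fin m → A) →
  length (filter P? (tabulate f)) ≡ count (does ∘ P? ∘ f)
length-filter-tabulate {zero}  P? f = refl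
length-filter-tabulate {suc m} P? f with does (P? (f zero))
... | true  = cong suc (length-filter-tabulate P? (f ∘ suc))
... | false = length-filter-tabulate P? (f ∘ suc)

_≟ˢ_ : ∀ {n} (x y : Subset n) → Dec (x ≡ y)
_≟ˢ_ = ≡-dec Bool._≟_

image : ∀ {m n} → (Fin m → Subset n) → (Fin m → Bool) → Family n
image {zero}  f h x = false
image {suc m} f h x = (h zero ∧ does (f zero ≟ˢ x)) ∨ image (f ∘ suc) (h ∘ suc) x

image-elim : ∀ {m n} (f : Fin m → Subset n) h x → image f h ∋ x → ∃[ i ] (f i ≡ x × h i ≡ true)
image-elim {suc m} f h x p with h zero in eq | f zero ≟ˢ x
... | true  | yes e = zero , e , eq
... | true  | no _  = let i , e , q = image-elim (f ∘ suc) (h ∘ suc) x p in suc i , e , q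
... | false | _     = let i , e , q = image-elim (f ∘ suc) (h ∘ suc) x p in suc i , e , q

image-intro : ∀ {m n} (f : Fin m → Subset n) h i → h i ≡ true → image f h ∋ f i
image-intro f h zero p rewrite p with f zero ≟ˢ f zero
... | yes _ = refl
... | no ne = ⊥-elim (ne refl)
image-intro f h (suc i) p = ∨-intro₂ _ (image-intro (f ∘ suc) (h ∘ suc) i p)

-- By injectivity, a selected first set is absent from the image of the later indices, so it
-- enlarges the family strictly.
card-image : ∀ {m n} (f : Fin m → Subset n) → Injective _≡_ _≡_ f → ∀ h → count h ≤ card (image f h)
card-image {zero}  f inj h = z≤n
card-image {suc m} f inj h = by-cases (h zero) refl
  where
  rest = image (f ∘ suc) (h ∘ suc)
  rec : count (h ∘ suc) ≤ card rest
  rec = card-image (f ∘ suc) (sucᶠ-injective ∘ inj) (h ∘ suc)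
  by-cases : ∀ b → h zero ≡ b → ind (h zero) + count (h ∘ suc) ≤ card (image f h)
  by-cases false e rewrite e = rec
  by-cases true e = ≤-trans (≤-reflexive (cong (λ b → ind b + count (h ∘ suc)) e))
    (≤-trans (s≤s rec) (card-mono-< (λ x → ∨-intro₂ _) (f zero) new (image-intro f h zero e)))
    where
    new : rest (f zero) ≡ false
    new with rest (f zero) in eq
    ... | false = refl
    ... | true with image-elim (f ∘ suc) (h ∘ suc) (f zero) eq
    ...   | i , e′ , _ with inj e′
    ...     | ()

bounded : ∀ {m} (c : Fin m → ℕ) → ∃[ t ] (∀ i → c i < t)
bounded {zero}  c = 0 , λ ()
bounded {suc m} c =
  let t , lt = bounded (c ∘ suc)
  in suc (c zero) + t , λ { zero → m≤m+n _ t ; (suc i) → ≤-trans (lt i) (m≤n+m t _) }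

ind-<ᵇ-suc : ∀ x t → ind (x <ᵇ t) + ind (x ≡ᵇ t) ≡ ind (x <ᵇ suc t)
ind-<ᵇ-suc zero    zero    = refl
ind-<ᵇ-suc zero    (suc t) = refl
ind-<ᵇ-suc (suc x) zero    = refl
ind-<ᵇ-suc (suc x) (suc t) = ind-<ᵇ-suc x t

-- Either the colours below some t or the single colour t form one side of a balanced split.
split : ∀ {m} (c : Fin m → ℕ) a e → 2 * e ≤ a → 0 < e * m →
  (∀ t → (a + e) * count (λ i → c i ≡ᵇ t) ≤ a * m) →
  ∃[ h ] (e * m ≤ (a + e) * count (h ∘ c) × (a + e) * count (h ∘ c) ≤ a * m)
split {m} c a e 2e≤a em>0 parts = finish (walk t₀)
  where
  d = a + e
  Split = ∃[ h ] (e * m ≤ d * count (h ∘ c) × d * count (h ∘ c) ≤ a * m)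
  size : ℕ → ℕ
  size t = count (λ i → c i ≡ᵇ t)
  below : ℕ → ℕ
  below t = count (λ i → c i <ᵇ t)
  t₀ = proj₁ (bounded c)
  below-0 : d * below 0 ≡ 0
  below-0 = trans (cong (d *_) (count-false m)) (*-zeroʳ d)
  below-suc : ∀ t → below (suc t) ≡ below t + size t
  below-suc t = sym (count-+ _ _ _ (λ i → ind-<ᵇ-suc (c i) t))
  walk : ∀ t → Split ⊎ d * below t < e * m
  walk zero    = inj₂ (subst (_< e * m) (sym below-0) em>0)
  walk (suc t) with walk t
  ... | inj₁ s  = inj₁ s
  ... | inj₂ lt with e * m ≤? d * below (suc t)
  ...   | no small  = inj₂ (≰⇒> small)
  ...   | yes large with d * below (suc t) ≤? a * m
  ...     | yes fits = inj₁ ((_<ᵇ suc t) , large , fits)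
  -- The sum jumps from below e·m to above a·m, so class `t` alone contributes at least (a - e)m ≥
  -- e·m; `parts` bounds it above.
  ...     | no over  = inj₁ ((_≡ᵇ t) , +-cancelˡ-≤ (e * m) _ _ (begin
    e * m + e * m              ≡⟨ *-distribʳ-+ m e e ⟨
    (e + e) * m                ≤⟨ *-monoˡ-≤ m (≤-trans (≤-reflexive (cong (e +_) (sym (+-identityʳ e)))) 2e≤a) ⟩
    a * m                      ≤⟨ <⇒≤ (≰⇒> over) ⟩
    d * below (suc t)          ≡⟨ cong (d *_) (below-suc t) ⟩
    d * (below t + size t)     ≡⟨ *-distribˡ-+ d (below t) (size t) ⟩
    d * below t + d * size t   ≤⟨ +-monoˡ-≤ (d * size t) (<⇒≤ lt) ⟩
    e * m + d * size t         ∎) , parts t)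
    where open ≤-Reasoning
  finish : Split ⊎ d * below t₀ < e * m → Split
  finish (inj₁ s)  = s
  -- All colours are below `t₀`, so the last sum is d·m and cannot be below e·m.
  finish (inj₂ lt) = ⊥-elim (<⇒≱ lt (≤-trans (*-monoˡ-≤ m (m≤n+m e a)) (≤-reflexive (cong (d *_) (sym all)))))
    where
    all : below t₀ ≡ m
    all = trans (count-cong (λ i → dec-true (c i <? t₀) (proj₂ (bounded c) i))) (count-true m)

nonempty⇒meets : ∀ {n} (x y : Subset n) → Nonempty (x ∩ y) → meets x y ≡ true
nonempty⇒meets (true ∷ x)  (true ∷ y)  _ = refl
nonempty⇒meets (true ∷ x)  (false ∷ y) (suc i , there p) = nonempty⇒meets x y (i , p)
nonempty⇒meets (false ∷ x) (b ∷ y)     (suc i , there p) = nonempty⇒meets x y (i , p)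

-- From rational to natural inequalities

open import Data.Integer using (+_)

-- The denominator is `suc d`, following `mkℚᵘ`.
frac : ℕ → ℕ → ℚᵘ
frac x d = mkℚᵘ (+ x) d

frac-≤ : ∀ {p q x y d} → p ≤ℚ q → toℚᵘ p ≃ frac x d → toℚᵘ q ≃ frac y d → x ≤ y
frac-≤ {x = x} {y} {d} le ex ey with ℚᵘ.≤-respˡ-≃ ex (ℚᵘ.≤-respʳ-≃ ey (ℚ.toℚᵘ-mono-≤ le))
... | *≤* h = *-cancelʳ-≤ x y (suc d)
  (ℤ.drop‿+≤+ (subst₂ ℤ._≤_ (sym (ℤ.pos-* x (suc d))) (sym (ℤ.pos-* y (suc d))) h))

toℚᵘ-ℕ : ∀ x → toℚᵘ (ℕ→ℚ x) ≃ frac x 0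
toℚᵘ-ℕ x = ℚ.toℚᵘ-fromℚᵘ (frac x 0)

toℚᵘ-+ : ∀ {p q x y d} → toℚᵘ p ≃ frac x d → toℚᵘ q ≃ frac y d → toℚᵘ (p +ℚ q) ≃ frac (x + y) d
toℚᵘ-+ {p} {q} {x} {y} {d} ep eq = ℚᵘ.≃-trans (ℚ.toℚᵘ-homo-+ p q) (ℚᵘ.≃-trans (ℚᵘ.+-cong ep eq)
  (*≡* (trans (ring (+ x) (+ y) D)
    (cong₂ ℤ._*_ (sym (ℤ.pos-+ x y)) (sym (ℤ.pos-* (suc d) (suc d)))))))
  where
  D = + suc d
  ring : ∀ x y D → (x ℤ.* D ℤ.+ y ℤ.* D) ℤ.* D ≡ (x ℤ.+ y) ℤ.* (D ℤ.* D)
  ring = ℤ.solve-∀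

toℚᵘ-* : ∀ {p q x y d} → toℚᵘ p ≃ frac x 0 → toℚᵘ q ≃ frac y d → toℚᵘ (p *ℚ q) ≃ frac (x * y) d
toℚᵘ-* {p} {q} {x} {y} {d} ep eq = ℚᵘ.≃-trans (ℚ.toℚᵘ-homo-* p q) (ℚᵘ.≃-trans (ℚᵘ.*-cong ep eq)
  (*≡* (cong₂ ℤ._*_ (sym (ℤ.pos-* x y)) (cong +_ (sym (*-identityˡ (suc d)))))))

rescale : ∀ {p x} d → toℚᵘ p ≃ frac x 0 → toℚᵘ p ≃ frac (x * suc d) d
rescale {p} {x} d e = ℚᵘ.≃-trans e (*≡* (trans (sym (ℤ.pos-* x (suc d))) (sym (ℤ.*-identityʳ (+ (x * suc d))))))

-- The difference enters as a sum `y + z`, so no truncated subtraction arises.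
toℚᵘ-- : ∀ {p q x y z d} → toℚᵘ p ≃ frac x d → toℚᵘ q ≃ frac y d → x ≡ y + z → toℚᵘ (p - q) ≃ frac z d
toℚᵘ-- {p} {q} {x} {y} {z} {d} ep eq refl = ℚᵘ.≃-trans (ℚ.toℚᵘ-homo-+ p (- q))
  (ℚᵘ.≃-trans (ℚᵘ.+-cong ep (ℚᵘ.≃-trans (ℚ.toℚᵘ-homo‿- q) (ℚᵘ.-‿cong eq)))
  (*≡* (trans (cong (λ s → (s ℤ.* D ℤ.+ ℤ.- (+ y) ℤ.* D) ℤ.* D) (ℤ.pos-+ y z))
    (trans (ring (+ y) (+ z) D) (cong (+ z ℤ.*_) (sym (ℤ.pos-* (suc d) (suc d))))))))
  where
  D = + suc d
  ring : ∀ y z D → ((y ℤ.+ z) ℤ.* D ℤ.+ ℤ.- y ℤ.* D) ℤ.* D ≡ z ℤ.* (D ℤ.* D)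
  ring = ℤ.solve-∀

-- Writes p as a/(a + e), hence 1 - p as e/(a + e); `2e≤a` encodes p ≥ 2/3 and `e>0` encodes p < 1.
record Ratio (p : ℚ) : Set where
  field
    a e d-1 : ℕ
    a+e     : a + e ≡ suc d-1
    value   : toℚᵘ p ≃ frac a d-1
    2e≤a    : 2 * e ≤ a
    e>0     : 0 < e

  1-value : toℚᵘ (1ℚ - p) ≃ frac e d-1
  1-value = toℚᵘ-- {1ℚ} {p} (rescale {1ℚ} {1} d-1 ℚᵘ.≃-refl) value (trans (*-identityˡ _) (sym a+e))

ratio : ∀ p → (+ 2 / 3) ≤ℚ p → p <ℚ 1ℚ → Ratio p
ratio p@(mkℚ (+ a) d-1 _) (ℚ.*≤* h) (ℚ.*<* h′) = record
  { a = a ; e = e ; d-1 = d-1 ; a+e = a+e ; value = ℚᵘ.≃-refl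
  ; 2e≤a = +-cancelˡ-≤ (2 * a) _ _ (begin
      2 * a + 2 * e   ≡⟨ *-distribˡ-+ 2 a e ⟨
      2 * (a + e)       ≡⟨ cong (2 *_) a+e ⟩
      2 * suc d-1         ≤⟨ ℤ.drop‿+≤+ (subst₂ ℤ._≤_ (sym (ℤ.pos-* 2 (suc d-1))) (sym (ℤ.pos-* a 3)) h) ⟩
      a * 3               ≡⟨ *-comm a 3 ⟩
      3 * a               ≡⟨ +-comm a (2 * a) ⟩
      2 * a + a         ∎)
  ; e>0 = m<n⇒0<n∸m a<d }
  where
  open ≤-Reasoning
  e = suc d-1 ∸ a
  a<d : a < suc d-1
  a<d = ℤ.drop‿+<+ (subst₂ ℤ._<_ (ℤ.*-identityʳ (+ a)) (ℤ.*-identityˡ (+ suc d-1)) h′)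
  a+e : a + e ≡ suc d-1
  a+e = m+[n∸m]≡n (<⇒≤ a<d)
ratio (mkℚ (ℤ.-[1+ a ]) d-1 _) (ℚ.*≤* ()) _

-- The bound on |H|

record Large (n k : ℕ) : Set where
  field
    two-below-threshold : choose (2 + n) 2 (suc k) ≤ threshold n (suc k)
    four-below-star     : 4 * (suc k * choose n 2 (suc k)) ≤ suc n C k
    exceeds-threshold   : ∀ d e a → suc k * suc k * d ≤ n * e + d → e * (suc n C k) < d * a → threshold n (suc k) < a

-- For singletons D and the threshold vanish, so exceeding the threshold means being nonempty.
-- Larger sets use the estimates above.
large : ∀ n k → 4 * suc k * suc k + 3 ≤ 2 + n + 4 * suc k → Large n k
large n zero    h = record
  { two-below-threshold = z≤n
  ; four-below-star     = z≤n
  ; exceeds-threshold   = λ d e a _ lt → n≢0⇒n>0 λ { refl → n≮0 (subst (e * (suc n C 0) <_) (*-zeroʳ d) lt) }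
  }
large n (suc j) h = record
  { two-below-threshold = choose≤threshold n (2 + j) (≤-trans 2k≤ big)
  ; four-below-star     = 4kD≤S n j big
  ; exceeds-threshold   = threshold-< n j big
  }
  where
  open +-*-Solver
  big : (3 + 2 * j) * (3 + 2 * j) ≤ n
  big = +-cancelʳ-≤ (2 + 4 * (2 + j)) _ _ (≤-trans (≤-reflexive
    (solve 1 (λ j → (con 3 :+ con 2 :* j) :* (con 3 :+ con 2 :* j) :+ (con 2 :+ con 4 :* (con 2 :+ j)) :=
                    con 4 :* (con 2 :+ j) :* (con 2 :+ j) :+ con 3) refl j))
    (≤-trans h (≤-reflexive (solve 2 (λ n t → con 2 :+ n :+ t := n :+ (con 2 :+ t)) refl n (4 * (2 + j))))))
  2k≤ : 2 * (2 + j) ≤ (3 + 2 * j) * (3 + 2 * j)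
  2k≤ = ≤-trans (m≤m+n _ (5 + 10 * j + 4 * (j * j))) (≤-reflexive
    (solve 1 (λ j → con 2 :* (con 2 :+ j) :+ (con 5 :+ con 10 :* j :+ con 4 :* (j :* j)) :=
                    (con 3 :+ con 2 :* j) :* (con 3 :+ con 2 :* j)) refl j))

3≤ground : ∀ n k → 4 * suc k * suc k + 3 ≤ n + 4 * suc k → 3 ≤ n
3≤ground n k h = +-cancelʳ-≤ (4 * suc k) _ _ (≤-trans (≤-trans (≤-reflexive (+-comm 3 (4 * suc k)))
  (+-monoˡ-≤ 3 (m≤m*n (4 * suc k) (suc k)))) h)

module _ {n k m : ℕ} {p : ℚ} (L : Large n k) (R : Ratio p)
  (pn : suc k * suc k * (Ratio.a R + Ratio.e R) ≤ n * Ratio.e R + (Ratio.a R + Ratio.e R))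
  (H : CompleteMultipartiteSub (2 + n) (suc k) m)
  (parts : ∀ t → (Ratio.a R + Ratio.e R) * count (λ i → CompleteMultipartiteSub.colour H i ≡ᵇ t) ≤ Ratio.a R * m)
  where

  open Ratio R
  open CompleteMultipartiteSub H
  open Large L

  private
    d = a + e
    S = suc n C k

  side-uniform : ∀ h → Uniform 0 (suc k) (image vertex h)
  side-uniform h x q with image-elim vertex h x q
  ... | i , refl , _ = isKSet i

  sides-cross : ∀ h → Crossing (image vertex (h ∘ colour)) (image vertex (not ∘ h ∘ colour))
  sides-cross h x y q r with image-elim vertex (h ∘ colour) x q | image-elim vertex (not ∘ h ∘ colour) y r
  -- Vertices of equal colour are on the same side of `h`, so vertices from opposite sides are
  -- adjacent.
  ... | i , refl , u | j , refl , v = nonempty⇒meets _ _ (crossAdj i j λ same →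
    false≢true (trans (cong not (sym (trans (cong h (sym same)) u))) v))

  -- Assuming S < m, both sides of a balanced split exceed the threshold, so they share a star; but
  -- a star has at most S members.
  card-H : m ≤ S
  card-H = ≮⇒≥ contradict
    where
    contradict : ¬ S < m
    contradict S<m = <⇒≱ S<m all≤S
      where
      balanced = split colour a e 2e≤a (*-mono-< e>0 (≤-trans (s≤s z≤n) S<m)) parts
      h = proj₁ balanced
      A = image vertex (h ∘ colour)
      B = image vertex (not ∘ h ∘ colour)
      cA = count (h ∘ colour)
      cB = count (not ∘ h ∘ colour)
      cA+cB : cA + cB ≡ m
      cA+cB = trans (count-+ (h ∘ colour) (not ∘ h ∘ colour) (λ _ → true) (λ i → ind-not (h (colour i)))) (count-true m)
        where
        ind-not : ∀ b → ind b + ind (not b) ≡ 1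
        ind-not true  = refl
        ind-not false = refl
      large-side : ∀ {c} g → c ≡ count g → e * m ≤ d * c → threshold n (suc k) < card (image vertex g)
      large-side g refl le = exceeds-threshold d e _ pn
        (<-≤-trans (*-monoʳ-< e {{>-nonZero e>0}} S<m) (≤-trans le (*-monoʳ-≤ d (card-image vertex injective g))))
      -- The upper bound on one side is the lower bound on its complement.
      em≤dcB : e * m ≤ d * cB
      em≤dcB = +-cancelˡ-≤ (a * m) _ _ (begin
        a * m + e * m       ≡⟨ *-distribʳ-+ m a e ⟨
        d * m               ≡⟨ cong (d *_) cA+cB ⟨
        d * (cA + cB)       ≡⟨ *-distribˡ-+ d cA cB ⟩
        d * cA + d * cB     ≤⟨ +-monoˡ-≤ (d * cB) (proj₂ (proj₂ balanced)) ⟩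
        a * m + d * cB      ∎)
        where open ≤-Reasoning
      both : 4 * (suc k * choose n 2 (suc k)) < card A + card B
      both = ≤-<-trans four-below-star (<-≤-trans S<m (≤-trans (≤-reflexive (sym cA+cB))
        (+-mono-≤ (card-image vertex injective (h ∘ colour)) (card-image vertex injective (not ∘ h ∘ colour)))))
      common : CommonStar A B
      common = common-star two-below-threshold A B (side-uniform (h ∘ colour)) (side-uniform (not ∘ h ∘ colour)) (sides-cross h)
        (large-side (h ∘ colour) refl (proj₁ (proj₂ balanced))) (large-side (not ∘ h ∘ colour) refl em≤dcB) both
      q = proj₁ common
      vertex-star : ∀ i → star q (vertex i) ≡ true
      vertex-star i = by-side (h (colour i)) refl
        where
        by-side : ∀ b → h (colour i) ≡ b → star q (vertex i) ≡ true
        by-side true  r = proj₁ (proj₂ common) (vertex i) (image-intro vertex (h ∘ colour) i r)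
        by-side false r = proj₂ (proj₂ common) (vertex i) (image-intro vertex (not ∘ h ∘ colour) i (cong not r))
      all≤S : m ≤ S
      all≤S = begin
        m                                    ≡⟨ count-true m ⟨
        count {m} (λ _ → true)               ≤⟨ card-image vertex injective (λ _ → true) ⟩
        card (image vertex (λ _ → true))     ≤⟨ card-star (side-uniform (λ _ → true)) q in-star ⟩
        S                                    ∎
        where
        open ≤-Reasoning
        in-star : image vertex (λ _ → true) ⊑ star q
        in-star x r with image-elim vertex (λ _ → true) x r
        ... | i , refl , _ = vertex-star i

-- Of the two lower bounds on `n`, the first has `4 * k` moved across to avoid truncated
-- subtraction, and the second is multiplied by the positive number 1 - p.
theorem3 : (k : ℕ) → 1 ≤ k → (p : ℚ) → (+ 2 / 3) ≤ℚ p → p <ℚ 1ℚ →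
    (n : ℕ) → 4 * k * k + 3 ≤ n + 4 * k →
    (ℕ→ℚ (k * k) - 1ℚ) +ℚ (ℕ→ℚ 2 *ℚ (1ℚ - p)) ≤ℚ ℕ→ℚ n *ℚ (1ℚ - p) →
    (m : ℕ) → (H : CompleteMultipartiteSub n k m) →
    (∀ c → ℕ→ℚ (partSize H c) ≤ℚ p *ℚ ℕ→ℚ m) →
    m ≤ (n ∸ 1) C (k ∸ 1)
theorem3 (suc k) _ p 2/3≤p p<1 n hn hp m H hc with 3≤ground n k hn
theorem3 (suc k) _ p 2/3≤p p<1 (suc (suc n)) hn hp m H hc | s≤s (s≤s _) =
  card-H {p = p} (large n k hn) R pn H parts
  where
  R = ratio p 2/3≤p p<1
  open Ratio R
  -- `suc k * suc k` computes to `suc z`, so `z` is the square minus one.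
  z = k + k * suc k
  scaled : z * suc d-1 + 2 * e ≤ (2 + n) * e
  scaled = frac-≤ hp
    (toℚᵘ-+ {ℕ→ℚ (suc k * suc k) - 1ℚ} {ℕ→ℚ 2 *ℚ (1ℚ - p)}
      (rescale {ℕ→ℚ (suc k * suc k) - 1ℚ} d-1 (toℚᵘ-- {ℕ→ℚ (suc k * suc k)} {1ℚ} (toℚᵘ-ℕ (suc k * suc k)) (toℚᵘ-ℕ 1) refl))
      (toℚᵘ-* {ℕ→ℚ 2} {1ℚ - p} (toℚᵘ-ℕ 2) 1-value))
    (toℚᵘ-* {ℕ→ℚ (2 + n)} {1ℚ - p} (toℚᵘ-ℕ (2 + n)) 1-value)
  pn : suc k * suc k * (a + e) ≤ n * e + (a + e)
  pn rewrite a+e = ≤-trans (≤-reflexive (+-comm (suc d-1) (z * suc d-1))) (+-monoˡ-≤ (suc d-1)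
    (+-cancelʳ-≤ (2 * e) _ _ (≤-trans scaled (≤-reflexive (trans (*-distribʳ-+ e 2 n) (+-comm (2 * e) (n * e)))))))
  open CompleteMultipartiteSub H
  parts : ∀ t → (a + e) * count (λ i → colour i ≡ᵇ t) ≤ a * m
  parts t rewrite a+e = begin
    suc d-1 * count (λ i → colour i ≡ᵇ t)   ≡⟨ *-comm (suc d-1) _ ⟩
    count (λ i → colour i ≡ᵇ t) * suc d-1   ≡⟨ cong (_* suc d-1) (length-filter-tabulate (λ i → colour i ≟ t) id) ⟨
    partSize H t * suc d-1                  ≤⟨ frac-≤ (subst (ℕ→ℚ (partSize H t) ≤ℚ_) (ℚ.*-comm p (ℕ→ℚ m)) (hc t))
                                                 (rescale {ℕ→ℚ (partSize H t)} d-1 (toℚᵘ-ℕ (partSize H t)))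
                                                 (toℚᵘ-* {ℕ→ℚ m} {p} (toℚᵘ-ℕ m) value) ⟩
    m * a                                   ≡⟨ *-comm m a ⟩
    a * m                                   ∎
    where open ≤-Reasoning
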